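{- For a UC family $\mathcal{A}$ with $U(\mathcal{A})=[n]$ and $\emptyset\in\mathcal{A}$, nonemptiness of $Z(\mathcal{A})$ does not necessarily imply that there exists a feasible solution of $I^{\mathcal{A}}$. That is, there exist $n\ge1$ and a UC family $\mathcal{A}$ with $U(\mathcal{A})=[n]$ and $\emptyset\in\mathcal{A}$ such that $Z(\mathcal{A})\neq\emptyset$ but $I^{\mathcal{A}}$ has no feasible solution.
   Context: A UC (union-closed) family is a nonempty finite family $\mathcal{F}$ of distinct finite sets such that $A\cup B\in\mathcal{F}$ for all $A,B\in\mathcal{F}$. $[n]=\{1,\dots,n\}$, $\mathcal{P}([n])$ is its power set, $U(\mathcal{F})$ is the union of all sets in $\mathcal{F}$, $\mathcal{F}_i=\{F\in\mathcal{F} : i\in F\}$, and $\mathcal{A}\uplus\mathcal{B}=\{A\cup B : A\in\mathcal{A},B\in\mathcal{B}\}$. $Z(\mathcal{A})$ is the set of integer vectors $z\in\mathbb{Z}^n$ with $z_i\ge0$ for all $i\in[n]$, $\sum_{i\in[n]}z_i\ge1$, and, for each $j\in[n]$, with $\mathcal{B}=\mathcal{P}([n]\setminus\{j\})\uplus\mathcal{A}$, $$\sum_{S\in\mathcal{B}}\left(\sum_{i\in S}z_i-\sum_{i\notin S}z_i\right)\ge0$$ (where $i\notin S$ means $i\in[n]\setminus S$). $I^{\mathcal{A}}$ is the integer program of minimizing $\sum_{i\in[n]}z_i$ over $z\in\mathbb{Z}_{\ge0}^n$ subject to $\sum_{i\in[n]}z_i\ge1$ and $\sum_{i\in[n]}z_i|\mathcal{B}_i|\ge(|\mathcal{B}|/2)\sum_{i\in[n]}z_i$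 for every UC family $\mathcal{B}\subseteq\mathcal{P}([n])$ with $\mathcal{B}\uplus\mathcal{A}=\mathcal{B}$. A feasible solution is a vector $z\in\mathbb{Z}_{\ge0}^n$ satisfying all these constraints. -}

module Defs where

open import Data.Bool.Properties using () renaming (_≟_ to _≟ᵇ_)
open import Data.Fin.Base using (Fin)
open import Data.Fin.Subset
  using (Subset; inside; outside; ⁅_⁆; ∁; _∪_; ⋃; _⊆_)
open import Data.Fin.Subset.Properties using (_∈?_; out⊆; s⊆s; drop-∷-⊆)
open import Data.Integer.Base using (ℤ; +_; 0ℤ; 1ℤ; _+_; _-_; _*_; _≤_)
open import Data.List.Base
  using (List; []; _∷_; [_]; _++_; map; filter; foldr; length; allFin;
         cartesianProductWith; deduplicate)
open import Data.List.Membership.Propositional using (_∈_)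
open import Data.List.Membership.Propositional.Properties
  using (∈-map⁺; ∈-map⁻; ∈-++⁺ˡ; ∈-++⁺ʳ; ∈-++⁻)
open import Data.List.Relation.Binary.BagAndSetEquality using (_∼[_]_; set)
open import Data.List.Relation.Unary.Any using (here)
open import Data.List.Relation.Unary.Unique.Propositional using (Unique)
open import Data.Nat.Base using (ℕ)
open import Data.Product.Base using (_,_)
open import Data.Rational.Unnormalised.Base as ℚᵘ using (_/_)
open import Data.Sum.Base using (inj₁; inj₂)
open import Data.Vec.Base using ([]; _∷_; here)
open import Data.Vec.Properties using (≡-dec)
open import Relation.Binary.Definitions using (DecidableEquality)
open import Relation.Binary.PropositionalEquality using (_≢_; refl)

private
  variable
    n : ℕ

-- [n] is Fin n. Only lists without repetitions represent families faithfully as far as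
-- cardinalities and sums are concerned.
Family : ℕ → Set
Family n = List (Subset n)

_≟ˢ_ : DecidableEquality (Subset n)
_≟ˢ_ = ≡-dec _≟ᵇ_

record UnionClosed (ℱ : Family n) : Set where
  field
    distinct : Unique ℱ
    nonempty : ℱ ≢ []
    closed   : ∀ {S T} → S ∈ ℱ → T ∈ ℱ → S ∪ T ∈ ℱ

U : Family n → Subset n
U = ⋃

infixl 8 _at_

-- ℱ at i is ℱᵢ = { F ∈ ℱ : i ∈ F }.
_at_ : Family n → Fin n → Family n
ℱ at i = filter (i ∈?_) ℱ

infixr 6 _⊎ᶠ_

-- Different pairs may have the same union, hence the deduplication.
_⊎ᶠ_ : Family n → Family n → Family n
𝒜 ⊎ᶠ ℬ = deduplicate _≟ˢ_ (cartesianProductWith _∪_ 𝒜 ℬ)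

𝒫 : Subset n → Family n
𝒫 []            = [ [] ]
𝒫 (outside ∷ T) = map (outside ∷_) (𝒫 T)
𝒫 (inside  ∷ T) = map (outside ∷_) (𝒫 T) ++ map (inside ∷_) (𝒫 T)

∈𝒫⁺ : {S T : Subset n} → S ⊆ T → S ∈ 𝒫 T
∈𝒫⁺ {S = []}          {[]}          _   = here refl
∈𝒫⁺ {S = outside ∷ S} {outside ∷ T} S⊆T = ∈-map⁺ _ (∈𝒫⁺ (drop-∷-⊆ S⊆T))
∈𝒫⁺ {S = inside  ∷ S} {outside ∷ T} S⊆T with () ← S⊆T here
∈𝒫⁺ {S = outside ∷ S} {inside  ∷ T} S⊆T = ∈-++⁺ˡ (∈-map⁺ _ (∈𝒫⁺ (drop-∷-⊆ S⊆T)))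
∈𝒫⁺ {S = inside  ∷ S} {inside  ∷ T} S⊆T =
  ∈-++⁺ʳ (map (outside ∷_) (𝒫 T)) (∈-map⁺ _ (∈𝒫⁺ (drop-∷-⊆ S⊆T)))

∈𝒫⁻ : {S T : Subset n} → S ∈ 𝒫 T → S ⊆ T
∈𝒫⁻ {T = []}          (here refl) = λ ()
∈𝒫⁻ {T = outside ∷ T} S∈ with _ , S′∈ , refl ← ∈-map⁻ _ S∈ = s⊆s (∈𝒫⁻ S′∈)
∈𝒫⁻ {T = inside  ∷ T} S∈ with ∈-++⁻ (map (outside ∷_) (𝒫 T)) S∈
... | inj₁ S∈ˡ with _ , S′∈ , refl ← ∈-map⁻ _ S∈ˡ = out⊆ (∈𝒫⁻ S′∈)
... | inj₂ S∈ʳ with _ , S′∈ , refl ← ∈-map⁻ _ S∈ʳ = s⊆s (∈𝒫⁻ S′∈)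

∑ : {A : Set} → List A → (A → ℤ) → ℤ
∑ xs f = foldr _+_ 0ℤ (map f xs)

elements : Subset n → List (Fin n)
elements S = filter (_∈? S) (allFin _)

record Z (𝒜 : Family n) (z : Fin n → ℤ) : Set where
  field
    nonnegative : ∀ i → 0ℤ ≤ z i
    positive    : 1ℤ ≤ ∑ (allFin n) z
    balanced    : ∀ j →
      0ℤ ≤ ∑ (𝒫 (∁ ⁅ j ⁆) ⊎ᶠ 𝒜) (λ S → ∑ (elements S) z - ∑ (elements (∁ S)) z)

-- Set equality _∼[ set ]_ is used since lists representing the same family
-- may differ in their order.
record Feasible (𝒜 : Family n) (z : Fin n → ℤ) : Set where
  field
    nonnegative : ∀ i → 0ℤ ≤ z i
    positive    : 1ℤ ≤ ∑ (allFin n) z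
    frankl      : ∀ (ℬ : Family n) → UnionClosed ℬ → ℬ ⊎ᶠ 𝒜 ∼[ set ] ℬ →
      (+ length ℬ / 2) ℚᵘ.* (∑ (allFin n) z / 1)
        ℚᵘ.≤ ∑ (allFin n) (λ i → z i * + length (ℬ at i)) / 1

{-# OPTIONS --safe #-}
-- The counterexample lives on [6] (here 0, …, 5): 𝒜 consists of the unions of {0,1,2},
-- {0,1,2,3}, {0,1,4,5} and {2,3,5}.  Each UC family ℬ with ℬ ⊎ 𝒜 = ℬ puts the constraint
-- ∑ᵢ zᵢ (2|ℬᵢ| − |ℬ|) ≥ 0 on a feasible z.  Take 𝒫([6] ∖ {j}) ⊎ 𝒜 for all j, except that
-- for j = 0 and j = 1 the family is enlarged by the generator {0,1,4}.  A combination of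
-- these six constraints with positive multipliers gives every zᵢ a negative coefficient;
-- without the enlargement they are the constraints defining Z(𝒜), which can be satisfied.
module Submission where

open import Algebra.Bundles using (module CommutativeMonoid)
open import Algebra.Properties.CommutativeSemigroup as CommutativeSemigroupProperties using ()
open import Data.Fin.Base using (Fin)
open import Data.Fin.Patterns using (0F; 1F; 2F; 3F; 4F; 5F)
open import Data.Fin.Properties using (all?)
open import Data.Fin.Subset using (Subset; ⊤; ⊥; ⁅_⁆; ∁; _∪_; ⋃)
open import Data.Fin.Subset.Properties
  using (∪-assoc; ∪-idem; ∪-identityʳ; ∪-commutativeMonoid)
open import Data.Integer.Base
  using (ℤ; +_; 0ℤ; 1ℤ; -1ℤ; -_; _+_; _-_; _*_; nonNegative; +≤+)
  renaming (_≤_ to _≤ᶻ_)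
open import Data.Integer.Properties
  using (+-mono-≤; *-monoˡ-≤-nonNeg; neg-mono-≤; i≤j⇒0≤j-i; *-zeroʳ)
  renaming (≤-refl to ≤ᶻ-refl; _≤?_ to _≤ᶻ?_; module ≤-Reasoning to ≤ᶻ-Reasoning)
open import Data.Integer.Tactic.RingSolver using (solve-∀)
open import Data.List.Base using (List; []; _∷_; [_]; _++_; map; length; allFin; deduplicate)
open import Data.List.Membership.Propositional using (_∈_)
open import Data.List.Membership.Propositional.Properties
  using (∈-map⁺; ∈-map⁻; ∈-++⁺ˡ; ∈-++⁺ʳ; ∈-++⁻; ∈-deduplicate⁺; ∈-deduplicate⁻;
         ∈-cartesianProductWith⁺; ∈-cartesianProductWith⁻)
open import Data.List.Relation.Binary.BagAndSetEquality using (_∼[_]_; set)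
open import Data.List.Relation.Unary.All using (All; []; _∷_; universal)
open import Data.List.Relation.Unary.All.Properties using (map⁺)
open import Data.List.Relation.Unary.AllPairs using ([]; _∷_)
open import Data.List.Relation.Unary.Any using (here)
open import Data.List.Relation.Unary.Unique.Propositional using (Unique)
open import Data.List.Relation.Unary.Unique.DecPropositional.Properties using (deduplicate-!)
open import Data.Nat.Base using (ℕ; _≤_; z≤n; s≤s)
open import Data.Product.Base using (Σ-syntax; ∃; _×_; _,_; map₂)
open import Data.Rational.Unnormalised.Properties using (drop-*≤*)
open import Data.Sum.Base as Sum using (_⊎_; inj₁; inj₂)
open import Data.Vec.Base using ([]; _∷_; lookup)
open import Function.Bundles using (mk⇔)
open import Relation.Binary.PropositionalEquality
  using (_≡_; refl; sym; trans; cong; cong₂; subst; module ≡-Reasoning)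
open import Relation.Nullary.Decidable using (from-yes)
open import Relation.Nullary.Negation using (¬_; contradiction)
open import Defs

private
  variable
    n : ℕ
    A : Set
    𝒜 ℬ : Family n
    z : Fin n → ℤ

-- Finite integer sums.

∑-cong : (xs : List A) {f g : A → ℤ} → (∀ x → f x ≡ g x) → ∑ xs f ≡ ∑ xs g
∑-cong []       f≡g = refl
∑-cong (x ∷ xs) f≡g = cong₂ _+_ (f≡g x) (∑-cong xs f≡g)

∑-mono-≤ : (xs : List A) {f g : A → ℤ} → (∀ x → f x ≤ᶻ g x) → ∑ xs f ≤ᶻ ∑ xs g
∑-mono-≤ []       f≤g = ≤ᶻ-refl
∑-mono-≤ (x ∷ xs) f≤g = +-mono-≤ (f≤g x) (∑-mono-≤ xs f≤g)

-- Two coefficients let one identity serve below for scaled addition, for negation and for sums of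
-- zeros.
∑-linear : (xs : List A) (a b : ℤ) (f g : A → ℤ) →
  ∑ xs (λ x → a * f x + b * g x) ≡ a * ∑ xs f + b * ∑ xs g
∑-linear []       a b f g = lemma a b
  where
  lemma : ∀ a b → 0ℤ ≡ a * 0ℤ + b * 0ℤ
  lemma = solve-∀
∑-linear (x ∷ xs) a b f g = begin
  a * f x + b * g x + ∑ xs (λ y → a * f y + b * g y)
    ≡⟨ cong (λ r → a * f x + b * g x + r) (∑-linear xs a b f g) ⟩
  a * f x + b * g x + (a * ∑ xs f + b * ∑ xs g)
    ≡⟨ lemma a b (f x) (g x) (∑ xs f) (∑ xs g) ⟩
  a * (f x + ∑ xs f) + b * (g x + ∑ xs g)
    ∎
  where
  open ≡-Reasoning
  lemma : ∀ a b p q s t → a * p + b * q + (a * s + b * t) ≡ a * (p + s) + b * (q + t)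
  lemma = solve-∀

-- Integer form of the constraints and their nonnegative combinations.

excess : Family n → Fin n → ℤ
excess ℬ i = + 2 * + length (ℬ at i) - + length ℬ

frankl-excess : Feasible 𝒜 z → UnionClosed ℬ → ℬ ⊎ᶠ 𝒜 ∼[ set ] ℬ →
  0ℤ ≤ᶻ ∑ (allFin n) (λ i → z i * excess ℬ i)
frankl-excess {n = n} {z = z} {ℬ = ℬ} feasible uc stable = begin
  0ℤ
    -- Cross-multiplying the two fractions leaves the denominators as the factors `+ 2` and `1ℤ`.
    ≤⟨ i≤j⇒0≤j-i (drop-*≤* (Feasible.frankl feasible ℬ uc stable)) ⟩
  ∑ I zc * + 2 - + length ℬ * ∑ I z * 1ℤ
    ≡⟨ rearrange (∑ I zc) (+ length ℬ) (∑ I z) ⟩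
  + 2 * ∑ I zc + - + length ℬ * ∑ I z
    ≡⟨ ∑-linear I (+ 2) (- + length ℬ) zc z ⟨
  ∑ I (λ i → + 2 * zc i + - + length ℬ * z i)
    ≡⟨ ∑-cong I (λ i → factor (z i) (+ length (ℬ at i)) (+ length ℬ)) ⟩
  ∑ I (λ i → z i * excess ℬ i)
    ∎
  where
  open ≤ᶻ-Reasoning
  I = allFin n
  zc : Fin n → ℤ
  zc i = z i * + length (ℬ at i)
  rearrange : ∀ s l t → s * + 2 - l * t * 1ℤ ≡ + 2 * s + - l * t
  rearrange = solve-∀
  factor : ∀ x c l → + 2 * (x * c) + - l * x ≡ x * (+ 2 * c - l)
  factor = solve-∀

Stable : Family n → Family n → Set
Stable 𝒜 ℬ = UnionClosed ℬ × ℬ ⊎ᶠ 𝒜 ∼[ set ] ℬ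

combinedExcess : List (ℕ × Family n) → Fin n → ℤ
combinedExcess cs i = ∑ cs (λ (y , ℬ) → + y * excess ℬ i)

-- Valid inequalities stay valid when scaled by nonnegative factors and added. Multipliers from `ℕ`
-- are nonnegative by type.
frankl-combined : Feasible 𝒜 z → ∀ {cs} → All (λ (_ , ℬ) → Stable 𝒜 ℬ) cs →
  0ℤ ≤ᶻ ∑ (allFin n) (λ i → z i * combinedExcess cs i)
frankl-combined {n = n} {z = z} feasible [] = begin
  -- Both coefficients are zero, so the right side of `∑-linear` computes to `0ℤ`.
  0ℤ                                        ≡⟨ ∑-linear (allFin n) 0ℤ 0ℤ z z ⟨
  ∑ (allFin n) (λ i → 0ℤ * z i + 0ℤ * z i)  ≡⟨ ∑-cong (allFin n) (λ i → sym (*-zeroʳ (z i))) ⟩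
  ∑ (allFin n) (λ i → z i * 0ℤ)             ∎
  where open ≤ᶻ-Reasoning
frankl-combined {n = n} {z = z} feasible {(y , ℬ) ∷ cs} ((uc , stable) ∷ stables) = begin
  0ℤ
    ≡⟨ zeros (+ y) ⟩
  + y * 0ℤ + 1ℤ * 0ℤ
    ≤⟨ +-mono-≤ (*-monoˡ-≤-nonNeg (+ y) (frankl-excess feasible uc stable))
                (*-monoˡ-≤-nonNeg 1ℤ (frankl-combined feasible stables)) ⟩
  + y * ∑ I ze + 1ℤ * ∑ I zc
    ≡⟨ ∑-linear I (+ y) 1ℤ ze zc ⟨
  ∑ I (λ i → + y * ze i + 1ℤ * zc i)
    ≡⟨ ∑-cong I (λ i → factor (+ y) (z i) (excess ℬ i) (combinedExcess cs i)) ⟩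
  ∑ I (λ i → z i * combinedExcess ((y , ℬ) ∷ cs) i)
    ∎
  where
  open ≤ᶻ-Reasoning
  I = allFin n
  ze zc : Fin n → ℤ
  ze i = z i * excess ℬ i
  zc i = z i * combinedExcess cs i
  zeros : ∀ y → 0ℤ ≡ y * 0ℤ + 1ℤ * 0ℤ
  zeros = solve-∀
  factor : ∀ y x e c → y * (x * e) + 1ℤ * (x * c) ≡ x * (y * e + c)
  factor = solve-∀

-- The easy half of Farkas' lemma: since z is nonnegative with sum at least 1, the combination would
-- give 0 ≤ -∑z ≤ -1.
infeasible : (cs : List (ℕ × Family n)) → All (λ (_ , ℬ) → Stable 𝒜 ℬ) cs →
  (∀ i → combinedExcess cs i ≤ᶻ -1ℤ) → ¬ Feasible 𝒜 z
infeasible {n = n} {z = z} cs stables negative feasible = contradiction 0≤-1 λ ()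
  where
  open ≤ᶻ-Reasoning
  I = allFin n
  -- The vanishing second term brings the summand into the shape of `∑-linear`.
  negate : ∀ x → x * -1ℤ ≡ -1ℤ * x + 0ℤ * x
  negate = solve-∀
  collect : ∀ s → -1ℤ * s + 0ℤ * s ≡ - s
  collect = solve-∀
  weighted : ∀ i → z i * combinedExcess cs i ≤ᶻ z i * -1ℤ
  weighted i = *-monoˡ-≤-nonNeg (z i) (negative i)
    where instance _ = nonNegative (Feasible.nonnegative feasible i)
  0≤-1 : 0ℤ ≤ᶻ -1ℤ
  0≤-1 = begin
    0ℤ                                      ≤⟨ frankl-combined feasible stables ⟩
    ∑ I (λ i → z i * combinedExcess cs i)   ≤⟨ ∑-mono-≤ I weighted ⟩
    ∑ I (λ i → z i * -1ℤ)                   ≡⟨ ∑-cong I (λ i → negate (z i)) ⟩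
    ∑ I (λ i → -1ℤ * z i + 0ℤ * z i)        ≡⟨ ∑-linear I -1ℤ 0ℤ z z ⟩
    -1ℤ * ∑ I z + 0ℤ * ∑ I z                ≡⟨ collect (∑ I z) ⟩
    - ∑ I z                                 ≤⟨ neg-mono-≤ (Feasible.positive feasible) ⟩
    -1ℤ                                     ∎

-- Union-closed families given by generators.

span : List (Subset n) → Family n
span []       = [ ⊥ ]
-- Deduplicating at every stage makes lengths count sets, and keeps the lists short for the
-- evaluations below.
span (G ∷ Gs) = deduplicate _≟ˢ_ (span Gs ++ map (G ∪_) (span Gs))

∈-span-skip : ∀ (G : Subset n) Gs {S} → S ∈ span Gs → S ∈ span (G ∷ Gs)
∈-span-skip G Gs S∈ = ∈-deduplicate⁺ _≟ˢ_ (∈-++⁺ˡ S∈)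

∈-span-use : ∀ (G : Subset n) Gs {S} → S ∈ span Gs → G ∪ S ∈ span (G ∷ Gs)
∈-span-use G Gs S∈ = ∈-deduplicate⁺ _≟ˢ_ (∈-++⁺ʳ (span Gs) (∈-map⁺ (G ∪_) S∈))

∈-span-∷⁻ : ∀ (G : Subset n) Gs {S} → S ∈ span (G ∷ Gs) →
  S ∈ span Gs ⊎ ∃ λ T → T ∈ span Gs × S ≡ G ∪ T
∈-span-∷⁻ G Gs S∈ = Sum.map₂ (∈-map⁻ (G ∪_))
  (∈-++⁻ (span Gs) (∈-deduplicate⁻ _≟ˢ_ (span Gs ++ map (G ∪_) (span Gs)) S∈))

⊥∈span : (Gs : List (Subset n)) → ⊥ ∈ span Gs
⊥∈span []       = here refl
⊥∈span (G ∷ Gs) = ∈-span-skip G Gs (⊥∈span Gs)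

module _ {n : ℕ} where
  open CommutativeSemigroupProperties
    (CommutativeMonoid.commutativeSemigroup (∪-commutativeMonoid n)) public
    using (interchange; x∙yz≈z∙xy)

-- Induction on the generators: any occurrence of `G` moves to the front of the union, and two
-- occurrences merge by idempotence.
span-closed : (Gs : List (Subset n)) → ∀ {S T} → S ∈ span Gs → T ∈ span Gs → S ∪ T ∈ span Gs
span-closed []       (here refl) (here refl) = here (∪-idem ⊥)
span-closed (G ∷ Gs) S∈ T∈ with ∈-span-∷⁻ G Gs S∈ | ∈-span-∷⁻ G Gs T∈
... | inj₁ S∈′ | inj₁ T∈′ = ∈-span-skip G Gs (span-closed Gs S∈′ T∈′)
... | inj₂ (S , S∈′ , refl) | inj₁ T∈′ =
  subst (_∈ span (G ∷ Gs)) (sym (∪-assoc G S _)) (∈-span-use G Gs (span-closed Gs S∈′ T∈′))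
... | inj₁ S∈′ | inj₂ (T , T∈′ , refl) =
  subst (_∈ span (G ∷ Gs)) (x∙yz≈z∙xy G T _) (∈-span-use G Gs (span-closed Gs T∈′ S∈′))
... | inj₂ (S , S∈′ , refl) | inj₂ (T , T∈′ , refl) =
  subst (_∈ span (G ∷ Gs)) eq (∈-span-use G Gs (span-closed Gs S∈′ T∈′))
  where
  eq : G ∪ (S ∪ T) ≡ (G ∪ S) ∪ (G ∪ T)
  eq = trans (cong (_∪ (S ∪ T)) (sym (∪-idem G))) (interchange G G S T)

span-unionClosed : (Gs : List (Subset n)) → UnionClosed (span Gs)
span-unionClosed Gs = record
  { distinct = distinct Gs
  ; nonempty = λ eq → contradiction (subst (⊥ ∈_) eq (⊥∈span Gs)) λ ()
  ; closed   = span-closed Gs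
  }
  where
  distinct : (Gs : List (Subset n)) → Unique (span Gs)
  distinct []       = [] ∷ []
  distinct (G ∷ Gs) = deduplicate-! _≟ˢ_ (span Gs ++ map (G ∪_) (span Gs))

∈-span-++ : ∀ (Hs Gs : List (Subset n)) {S} → S ∈ span Gs → S ∈ span (Hs ++ Gs)
∈-span-++ []       Gs S∈ = S∈
∈-span-++ (H ∷ Hs) Gs S∈ = ∈-span-skip H (Hs ++ Gs) (∈-span-++ Hs Gs S∈)

-- The larger span contains the smaller one and is union-closed, so it absorbs it; conversely, every
-- member is its own union with `⊥`. Adding arbitrary generators thus yields admissible constraints.
span-++-stable : (Hs Gs : List (Subset n)) → Stable (span Gs) (span (Hs ++ Gs))
span-++-stable Hs Gs = span-unionClosed ℋ , mk⇔ absorb extend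
  where
  ℋ = Hs ++ Gs
  absorb : ∀ {S} → S ∈ span ℋ ⊎ᶠ span Gs → S ∈ span ℋ
  absorb S∈
    with _ , _ , T∈ , T′∈ , refl ← ∈-cartesianProductWith⁻ _∪_ (span ℋ) (span Gs)
                                     (∈-deduplicate⁻ _≟ˢ_ _ S∈)
    = span-closed ℋ T∈ (∈-span-++ Hs Gs T′∈)
  extend : ∀ {S} → S ∈ span ℋ → S ∈ span ℋ ⊎ᶠ span Gs
  extend {S} S∈ = ∈-deduplicate⁺ _≟ˢ_
    (subst (_∈ _) (∪-identityʳ S) (∈-cartesianProductWith⁺ _∪_ S∈ (⊥∈span Gs)))

-- The counterexample on six points.

⟨_⟩ : List (Fin n) → Subset n
⟨ is ⟩ = ⋃ (map ⁅_⁆ is)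

generators : List (Subset 6)
generators =
    ⟨ 0F ∷ 1F ∷ 2F ∷ [] ⟩
  ∷ ⟨ 0F ∷ 1F ∷ 2F ∷ 3F ∷ [] ⟩
  ∷ ⟨ 0F ∷ 1F ∷ 4F ∷ 5F ∷ [] ⟩
  ∷ ⟨ 2F ∷ 3F ∷ 5F ∷ [] ⟩
  ∷ []

weights : Fin 6 → ℤ
weights = lookup (+ 20 ∷ + 20 ∷ + 29 ∷ + 23 ∷ + 9 ∷ + 24 ∷ [])

weights-Z : Z (span generators) weights
weights-Z = record
  { nonnegative = from-yes (all? λ i → 0ℤ ≤ᶻ? weights i)
  ; positive    = +≤+ (s≤s z≤n)
  -- Six concrete inequalities, decided by evaluation.
  ; balanced    = from-yes (all? λ j → 0ℤ ≤ᶻ? ∑ (𝒫 (∁ ⁅ j ⁆) ⊎ᶠ span generators)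
                  (λ S → ∑ (elements S) weights - ∑ (elements (∁ S)) weights))
  }

-- Farkas multipliers, each with the sets to be added to `generators`. The singletons omit j = 2, 3,
-- 4, 5, 1, 0 in turn; together with `generators` they span 𝒫([6] ∖ {j}) ⊎ 𝒜. In the last two
-- entries {0,1,4} contributes exactly two new sets, {0,1,4} and {0,1,3,4}, which raises the excess
-- at 0, 1, 4 and lowers it at 2, 5. Exchanging 0 and 1 preserves `generators`, hence the equal
-- multipliers 38.
certificate : List (ℕ × List (Subset 6))
certificate =
    (30 , map ⁅_⁆ (0F ∷ 1F ∷ 3F ∷ 4F ∷ 5F ∷ []))
  ∷ (13 , map ⁅_⁆ (0F ∷ 1F ∷ 2F ∷ 4F ∷ 5F ∷ []))
  ∷ (13 , map ⁅_⁆ (0F ∷ 1F ∷ 2F ∷ 3F ∷ 5F ∷ []))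
  ∷ (15 , map ⁅_⁆ (0F ∷ 1F ∷ 2F ∷ 3F ∷ 4F ∷ []))
  ∷ (38 , ⟨ 0F ∷ 1F ∷ 4F ∷ [] ⟩ ∷ map ⁅_⁆ (0F ∷ 2F ∷ 3F ∷ 4F ∷ 5F ∷ []))
  ∷ (38 , ⟨ 0F ∷ 1F ∷ 4F ∷ [] ⟩ ∷ map ⁅_⁆ (1F ∷ 2F ∷ 3F ∷ 4F ∷ 5F ∷ []))
  ∷ []

constraint : List (Subset 6) → Family 6
constraint Hs = span (Hs ++ generators)

constraints : List (ℕ × Family 6)
constraints = map (map₂ constraint) certificate

constraints-stable : All (λ (_ , ℬ) → Stable (span generators) ℬ) constraints
constraints-stable = map⁺ {f = map₂ constraint}
  (universal (λ (_ , Hs) → span-++-stable Hs generators) certificate)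

constraints-negative : ∀ i → combinedExcess constraints i ≤ᶻ -1ℤ
constraints-negative = from-yes (all? λ i → combinedExcess constraints i ≤ᶻ? -1ℤ)

corollary6 : Σ[ n ∈ ℕ ] 1 ≤ n × (Σ[ 𝒜 ∈ Family n ]
    UnionClosed 𝒜 × U 𝒜 ≡ ⊤ × ⊥ ∈ 𝒜 ×
    (∃ λ z → Z 𝒜 z) × ¬ (∃ λ z → Feasible 𝒜 z))
corollary6 = 6 , s≤s z≤n , span generators ,
  span-unionClosed generators , refl , ⊥∈span generators ,
  (weights , weights-Z) ,
  λ (_ , feasible) → infeasible constraints constraints-stable constraints-negative feasible
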